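{- (Completeness of $\mathsf{LNIF}$.) For every first-order formula $A$, if $\vdash_{\mathsf{IF}} A$, then the linear nested sequent $\ \vdash A'$ (a single component with empty antecedent) is derivable in $\mathsf{LNIF}$, where $A'$ is obtained from $A$ by replacing its free variables by distinct parameters.
   Context: $\mathsf{IF}$ (intuitionistic fuzzy logic) is the smallest set of first-order formulae (over $\bot,\land,\lor,\supset,\forall,\exists$) containing all instances of: $A\supset(B\supset A)$; $(A\supset(B\supset C))\supset((A\supset B)\supset(A\supset C))$; $A\supset(B\supset(A\land B))$; $(A\land B)\supset A$; $(A\land B)\supset B$; $A\supset(A\lor B)$; $B\supset(A\lor B)$; $(A\supset C)\supset((B\supset C)\supset((A\lor B)\supset C))$; $\bot\supset A$; $(A\supset B)\lor(B\supset A)$; $\forall xA\supset A[y/x]$ and $A[y/x]\supset\exists xA$ ($y$ free for $x$); $\forall x(B\supset A(x))\supset(B\supset\forall xA(x))$ and $\forall x(A(x)\supset B)\supset(\exists xA(x)\supset B)$ and $\forall x(A(x)\lor B)\supset(\forall xA(x)\lor B)$ (with $x$ not free in $B$); and closed under modus ponens (from $A$ and $A\supset B$ infer $B$) and generalization (from $A$ infer $\forall xA$). $\vdash_{\mathsf{IF}}A$ means $A\in\mathsf{IF}$. Formulae in sequents: bound variables $x,y,\dots$ are distinct from parameters $a,b,\dots$, which occupy all free positions; $A[a/x]$ replaces free occurrences of $x$ by $a$; $p(\vec a)$ is an atomic formula with parameters $\vec a$. A linear nested sequent is $\Gamma_1\vdash\Delta_1 /\!/ \cdots /\!/ \Gamma_n\vdash\Delta_n$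 ($n\ge1$), each $\Gamma_i,\Delta_i$ a finite, possibly empty, multiset of formulae (a component). In rule schemas, $\mathcal{G},\mathcal{H},\mathcal{F}$ denote possibly empty sequences of components. $\mathsf{LNIF}$ has the rules (from premise(s) infer conclusion): Initial: $(id_1)$ $\mathcal{G}/\!/\Gamma,p(\vec a)\vdash p(\vec a),\Delta/\!/\mathcal{H}$; $(id_2)$ $\mathcal{G}/\!/\Gamma_1,p(\vec a)\vdash\Delta_1/\!/\mathcal{H}/\!/\Gamma_2\vdash p(\vec a),\Delta_2/\!/\mathcal{F}$; $(\bot_l)$ $\mathcal{G}/\!/\Gamma,\bot\vdash\Delta/\!/\mathcal{H}$. $(\land_l)$: from $\mathcal{G}/\!/\Gamma,A,B\vdash\Delta/\!/\mathcal{H}$ infer $\mathcal{G}/\!/\Gamma,A\land B\vdash\Delta/\!/\mathcal{H}$. $(\lor_r)$: from $\mathcal{G}/\!/\Gamma\vdash\Delta,A,B/\!/\mathcal{H}$ infer $\mathcal{G}/\!/\Gamma\vdash\Delta,A\lor B/\!/\mathcal{H}$. $(\land_r)$: from $\mathcal{G}/\!/\Gamma\vdash\Delta,A/\!/\mathcal{H}$ and $\mathcal{G}/\!/\Gamma\vdash\Delta,B/\!/\mathcal{H}$ infer $\mathcal{G}/\!/\Gamma\vdash\Delta,A\land B/\!/\mathcal{H}$. $(\lor_l)$: from $\mathcal{G}/\!/\Gamma,A\vdash\Delta/\!/\mathcal{H}$ and $\mathcal{G}/\!/\Gamma,B\vdash\Delta/\!/\mathcal{H}$ infer $\mathcal{G}/\!/\Gamma,A\lor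 B\vdash\Delta/\!/\mathcal{H}$. $(\supset_{r1})$: from $\mathcal{G}/\!/\Gamma\vdash\Delta/\!/A\vdash B$ infer $\mathcal{G}/\!/\Gamma\vdash\Delta,A\supset B$. $(\supset_l)$: from $\mathcal{G}/\!/\Gamma,B\vdash\Delta/\!/\mathcal{H}$ and $\mathcal{G}/\!/\Gamma,A\supset B\vdash A,\Delta/\!/\mathcal{H}$ infer $\mathcal{G}/\!/\Gamma,A\supset B\vdash\Delta/\!/\mathcal{H}$. $(lift)$: from $\mathcal{G}/\!/\Gamma_1,A\vdash\Delta_1/\!/\Gamma_2,A\vdash\Delta_2/\!/\mathcal{H}$ infer $\mathcal{G}/\!/\Gamma_1,A\vdash\Delta_1/\!/\Gamma_2\vdash\Delta_2/\!/\mathcal{H}$. $(\forall_l)$: from $\mathcal{G}/\!/\Gamma,A[a/x],\forall xA\vdash\Delta/\!/\mathcal{H}$ infer $\mathcal{G}/\!/\Gamma,\forall xA\vdash\Delta/\!/\mathcal{H}$ ($a$ any parameter). $(\forall_{r1})$: from $\mathcal{G}/\!/\Gamma\vdash\Delta/\!/\ \vdash A[a/x]$ infer $\mathcal{G}/\!/\Gamma\vdash\Delta,\forall xA$. $(\exists_l)$: from $\mathcal{G}/\!/\Gamma,A[a/x]\vdash\Delta/\!/\mathcal{H}$ infer $\mathcal{G}/\!/\Gamma,\exists xA\vdash\Delta/\!/\mathcal{H}$. $(\exists_r)$: from $\mathcal{G}/\!/\Gamma\vdash A[a/x],\exists xA,\Delta/\!/\mathcal{H}$ infer $\mathcal{G}/\!/\Gamma\vdash\exists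 xA,\Delta/\!/\mathcal{H}$ ($a$ any parameter). $(\supset_{r2})$: from $\mathcal{G}/\!/\Gamma_1\vdash\Delta_1/\!/A\vdash B/\!/\Gamma_2\vdash\Delta_2/\!/\mathcal{H}$ and $\mathcal{G}/\!/\Gamma_1\vdash\Delta_1/\!/\Gamma_2\vdash\Delta_2,A\supset B/\!/\mathcal{H}$ infer $\mathcal{G}/\!/\Gamma_1\vdash\Delta_1,A\supset B/\!/\Gamma_2\vdash\Delta_2/\!/\mathcal{H}$. $(\forall_{r2})$: from $\mathcal{G}/\!/\Gamma_1\vdash\Delta_1/\!/\ \vdash A[a/x]/\!/\Gamma_2\vdash\Delta_2/\!/\mathcal{H}$ and $\mathcal{G}/\!/\Gamma_1\vdash\Delta_1/\!/\Gamma_2\vdash\Delta_2,\forall xA/\!/\mathcal{H}$ infer $\mathcal{G}/\!/\Gamma_1\vdash\Delta_1,\forall xA/\!/\Gamma_2\vdash\Delta_2/\!/\mathcal{H}$. In $(\forall_{r1}),(\exists_l),(\forall_{r2})$, $a$ is an eigenvariable (does not occur in the conclusion). -}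

module Defs where

open import Data.Nat using (ℕ; _≡ᵇ_)
open import Data.Bool using (Bool; true; false; if_then_else_; _∨_)
open import Data.List using (List; []; _∷_; map; _++_)
open import Data.List.Membership.Propositional using (_∈_)
open import Data.List.Relation.Unary.Any using (Any)
open import Data.List.Relation.Binary.Permutation.Propositional using (_↭_)
open import Data.Product using (_×_)
open import Data.Sum using (_⊎_)
open import Data.Unit using (⊤)
open import Relation.Nullary using (¬_)
open import Relation.Binary.PropositionalEquality using (_≡_; _≢_)

-- Formulae, generic in the type T of term occurrences.
-- Predicate symbols and (bound/free) variable names are natural numbers.
-- The language has no function symbols: terms are variables (and, in
-- sequents, parameters).

infixr 6 _∧'_
infixr 5 _∨'_
infixr 4 _⊃_

data Fm (T : Set) : Set where
  atom : ℕ → List T → Fm T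
  ⊥'   : Fm T
  _∧'_ : Fm T → Fm T → Fm T
  _∨'_ : Fm T → Fm T → Fm T
  _⊃_  : Fm T → Fm T → Fm T
  all  : ℕ → Fm T → Fm T
  ex   : ℕ → Fm T → Fm T

IFm : Set
IFm = Fm ℕ

FreeIn : ℕ → IFm → Set
FreeIn x (atom p ts) = x ∈ ts
FreeIn x ⊥'          = Data.Empty.⊥ where import Data.Empty
FreeIn x (A ∧' B)    = FreeIn x A ⊎ FreeIn x B
FreeIn x (A ∨' B)    = FreeIn x A ⊎ FreeIn x B
FreeIn x (A ⊃ B)     = FreeIn x A ⊎ FreeIn x B
FreeIn x (all z A)   = x ≢ z × FreeIn x A
FreeIn x (ex z A)    = x ≢ z × FreeIn x A

_[_/_] : IFm → ℕ → ℕ → IFm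
atom p ts [ y / x ] = atom p (map (λ z → if z ≡ᵇ x then y else z) ts)
⊥'        [ y / x ] = ⊥'
(A ∧' B)  [ y / x ] = (A [ y / x ]) ∧' (B [ y / x ])
(A ∨' B)  [ y / x ] = (A [ y / x ]) ∨' (B [ y / x ])
(A ⊃ B)   [ y / x ] = (A [ y / x ]) ⊃ (B [ y / x ])
all z A   [ y / x ] = if z ≡ᵇ x then all z A else all z (A [ y / x ])
ex z A    [ y / x ] = if z ≡ᵇ x then ex z A else ex z (A [ y / x ])

FreeFor : ℕ → ℕ → IFm → Set
FreeFor y x (atom p ts) = ⊤
FreeFor y x ⊥'          = ⊤
FreeFor y x (A ∧' B)    = FreeFor y x A × FreeFor y x B
FreeFor y x (A ∨' B)    = FreeFor y x A × FreeFor y x B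
FreeFor y x (A ⊃ B)     = FreeFor y x A × FreeFor y x B
FreeFor y x (all z A)   = ¬ FreeIn x (all z A) ⊎ (z ≢ y × FreeFor y x A)
FreeFor y x (ex z A)    = ¬ FreeIn x (ex z A) ⊎ (z ≢ y × FreeFor y x A)

data IF : IFm → Set where
  ax1  : ∀ A B → IF (A ⊃ (B ⊃ A))
  ax2  : ∀ A B C → IF ((A ⊃ (B ⊃ C)) ⊃ ((A ⊃ B) ⊃ (A ⊃ C)))
  ax3  : ∀ A B → IF (A ⊃ (B ⊃ (A ∧' B)))
  ax4  : ∀ A B → IF ((A ∧' B) ⊃ A)
  ax5  : ∀ A B → IF ((A ∧' B) ⊃ B)
  ax6  : ∀ A B → IF (A ⊃ (A ∨' B))
  ax7  : ∀ A B → IF (B ⊃ (A ∨' B))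
  ax8  : ∀ A B C → IF ((A ⊃ C) ⊃ ((B ⊃ C) ⊃ ((A ∨' B) ⊃ C)))
  ax9  : ∀ A → IF (⊥' ⊃ A)
  lin  : ∀ A B → IF ((A ⊃ B) ∨' (B ⊃ A))
  q∀   : ∀ A x y → FreeFor y x A → IF (all x A ⊃ (A [ y / x ]))
  q∃   : ∀ A x y → FreeFor y x A → IF ((A [ y / x ]) ⊃ ex x A)
  q∀⊃  : ∀ A B x → ¬ FreeIn x B → IF (all x (B ⊃ A) ⊃ (B ⊃ all x A))
  q∃⊃  : ∀ A B x → ¬ FreeIn x B → IF (all x (A ⊃ B) ⊃ (ex x A ⊃ B))
  q∀∨  : ∀ A B x → ¬ FreeIn x B → IF (all x (A ∨' B) ⊃ (all x A ∨' B))
  mp   : ∀ {A B} → IF A → IF (A ⊃ B) → IF B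
  gen  : ∀ {A} x → IF A → IF (all x A)

-- Sequent formulae: term positions are bound variables or parameters

data Tm : Set where
  var : ℕ → Tm
  par : ℕ → Tm

SFm : Set
SFm = Fm Tm

_[_/p_] : SFm → ℕ → ℕ → SFm
atom p ts [ a /p x ] = atom p (map f ts)
  where
  f : Tm → Tm
  f (var z) = if z ≡ᵇ x then par a else var z
  f (par b) = par b
⊥'        [ a /p x ] = ⊥'
(A ∧' B)  [ a /p x ] = (A [ a /p x ]) ∧' (B [ a /p x ])
(A ∨' B)  [ a /p x ] = (A [ a /p x ]) ∨' (B [ a /p x ])
(A ⊃ B)   [ a /p x ] = (A [ a /p x ]) ⊃ (B [ a /p x ])
all z A   [ a /p x ] = if z ≡ᵇ x then all z A else all z (A [ a /p x ])
ex z A    [ a /p x ] = if z ≡ᵇ x then ex z A else ex z (A [ a /p x ])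

ParIn : ℕ → SFm → Set
ParIn a (atom p ts) = par a ∈ ts
ParIn a ⊥'          = Data.Empty.⊥ where import Data.Empty
ParIn a (A ∧' B)    = ParIn a A ⊎ ParIn a B
ParIn a (A ∨' B)    = ParIn a A ⊎ ParIn a B
ParIn a (A ⊃ B)     = ParIn a A ⊎ ParIn a B
ParIn a (all z A)   = ParIn a A
ParIn a (ex z A)    = ParIn a A

-- Linear nested sequents. A component Γ ⊢ Δ consists of two finite
-- multisets, represented as lists taken up to permutation (rule `perm`).

infix 3 _⊢_
record Comp : Set where
  constructor _⊢_
  field
    ant : List SFm
    suc : List SFm

LNS : Set
LNS = List Comp

ParInLNS : ℕ → LNS → Set
ParInLNS a S = Any (λ c → Any (ParIn a) (Comp.ant c) ⊎ Any (ParIn a) (Comp.suc c)) S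

data LNIF : LNS → Set where
  perm : ∀ {G H Γ Γ' Δ Δ'} → Γ ↭ Γ' → Δ ↭ Δ' →
         LNIF (G ++ (Γ ⊢ Δ) ∷ H) → LNIF (G ++ (Γ' ⊢ Δ') ∷ H)
  id₁  : ∀ {G H Γ Δ} p ts →
         LNIF (G ++ (atom p ts ∷ Γ ⊢ atom p ts ∷ Δ) ∷ H)
  id₂  : ∀ {G H F Γ₁ Δ₁ Γ₂ Δ₂} p ts →
         LNIF (G ++ (atom p ts ∷ Γ₁ ⊢ Δ₁) ∷ H ++ (Γ₂ ⊢ atom p ts ∷ Δ₂) ∷ F)
  ⊥l   : ∀ {G H Γ Δ} → LNIF (G ++ (⊥' ∷ Γ ⊢ Δ) ∷ H)
  ∧l   : ∀ {G H Γ Δ A B} →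
         LNIF (G ++ (A ∷ B ∷ Γ ⊢ Δ) ∷ H) → LNIF (G ++ ((A ∧' B) ∷ Γ ⊢ Δ) ∷ H)
  ∨r   : ∀ {G H Γ Δ A B} →
         LNIF (G ++ (Γ ⊢ A ∷ B ∷ Δ) ∷ H) → LNIF (G ++ (Γ ⊢ (A ∨' B) ∷ Δ) ∷ H)
  ∧r   : ∀ {G H Γ Δ A B} →
         LNIF (G ++ (Γ ⊢ A ∷ Δ) ∷ H) → LNIF (G ++ (Γ ⊢ B ∷ Δ) ∷ H) →
         LNIF (G ++ (Γ ⊢ (A ∧' B) ∷ Δ) ∷ H)
  ∨l   : ∀ {G H Γ Δ A B} →
         LNIF (G ++ (A ∷ Γ ⊢ Δ) ∷ H) → LNIF (G ++ (B ∷ Γ ⊢ Δ) ∷ H) →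
         LNIF (G ++ ((A ∨' B) ∷ Γ ⊢ Δ) ∷ H)
  ⊃r₁  : ∀ {G Γ Δ A B} →
         LNIF (G ++ (Γ ⊢ Δ) ∷ (A ∷ [] ⊢ B ∷ []) ∷ []) →
         LNIF (G ++ (Γ ⊢ (A ⊃ B) ∷ Δ) ∷ [])
  ⊃l   : ∀ {G H Γ Δ A B} →
         LNIF (G ++ (B ∷ Γ ⊢ Δ) ∷ H) → LNIF (G ++ ((A ⊃ B) ∷ Γ ⊢ A ∷ Δ) ∷ H) →
         LNIF (G ++ ((A ⊃ B) ∷ Γ ⊢ Δ) ∷ H)
  lift : ∀ {G H Γ₁ Δ₁ Γ₂ Δ₂ A} →
         LNIF (G ++ (A ∷ Γ₁ ⊢ Δ₁) ∷ (A ∷ Γ₂ ⊢ Δ₂) ∷ H) →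
         LNIF (G ++ (A ∷ Γ₁ ⊢ Δ₁) ∷ (Γ₂ ⊢ Δ₂) ∷ H)
  ∀l   : ∀ {G H Γ Δ A x} a →
         LNIF (G ++ ((A [ a /p x ]) ∷ all x A ∷ Γ ⊢ Δ) ∷ H) →
         LNIF (G ++ (all x A ∷ Γ ⊢ Δ) ∷ H)
  ∀r₁  : ∀ {G Γ Δ A x} a →
         ¬ ParInLNS a (G ++ (Γ ⊢ all x A ∷ Δ) ∷ []) →
         LNIF (G ++ (Γ ⊢ Δ) ∷ ([] ⊢ (A [ a /p x ]) ∷ []) ∷ []) →
         LNIF (G ++ (Γ ⊢ all x A ∷ Δ) ∷ [])
  ∃l   : ∀ {G H Γ Δ A x} a →
         ¬ ParInLNS a (G ++ (ex x A ∷ Γ ⊢ Δ) ∷ H) →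
         LNIF (G ++ ((A [ a /p x ]) ∷ Γ ⊢ Δ) ∷ H) →
         LNIF (G ++ (ex x A ∷ Γ ⊢ Δ) ∷ H)
  ∃r   : ∀ {G H Γ Δ A x} a →
         LNIF (G ++ (Γ ⊢ (A [ a /p x ]) ∷ ex x A ∷ Δ) ∷ H) →
         LNIF (G ++ (Γ ⊢ ex x A ∷ Δ) ∷ H)
  ⊃r₂  : ∀ {G H Γ₁ Δ₁ Γ₂ Δ₂ A B} →
         LNIF (G ++ (Γ₁ ⊢ Δ₁) ∷ (A ∷ [] ⊢ B ∷ []) ∷ (Γ₂ ⊢ Δ₂) ∷ H) →
         LNIF (G ++ (Γ₁ ⊢ Δ₁) ∷ (Γ₂ ⊢ (A ⊃ B) ∷ Δ₂) ∷ H) →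
         LNIF (G ++ (Γ₁ ⊢ (A ⊃ B) ∷ Δ₁) ∷ (Γ₂ ⊢ Δ₂) ∷ H)
  ∀r₂  : ∀ {G H Γ₁ Δ₁ Γ₂ Δ₂ A x} a →
         ¬ ParInLNS a (G ++ (Γ₁ ⊢ all x A ∷ Δ₁) ∷ (Γ₂ ⊢ Δ₂) ∷ H) →
         LNIF (G ++ (Γ₁ ⊢ Δ₁) ∷ ([] ⊢ (A [ a /p x ]) ∷ []) ∷ (Γ₂ ⊢ Δ₂) ∷ H) →
         LNIF (G ++ (Γ₁ ⊢ Δ₁) ∷ (Γ₂ ⊢ all x A ∷ Δ₂) ∷ H) →
         LNIF (G ++ (Γ₁ ⊢ all x A ∷ Δ₁) ∷ (Γ₂ ⊢ Δ₂) ∷ H)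

member : ℕ → List ℕ → Bool
member x []       = false
member x (y ∷ ys) = (x ≡ᵇ y) ∨ member x ys

toSFm : (ℕ → ℕ) → List ℕ → IFm → SFm
toSFm σ bs (atom p xs) = atom p (map (λ x → if member x bs then var x else par (σ x)) xs)
toSFm σ bs ⊥'          = ⊥'
toSFm σ bs (A ∧' B)    = toSFm σ bs A ∧' toSFm σ bs B
toSFm σ bs (A ∨' B)    = toSFm σ bs A ∨' toSFm σ bs B
toSFm σ bs (A ⊃ B)     = toSFm σ bs A ⊃ toSFm σ bs B
toSFm σ bs (all y A)   = all y (toSFm σ (y ∷ bs) A)
toSFm σ bs (ex y A)    = ex y (toSFm σ (y ∷ bs) A)

_′[_] : IFm → (ℕ → ℕ) → SFm
A ′[ σ ] = toSFm σ [] A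

DistinctOnFree : (ℕ → ℕ) → IFm → Set
DistinctOnFree σ A = ∀ x y → FreeIn x A → FreeIn y A → σ x ≡ σ y → x ≡ y

-- Cut elimination by evaluation in a model built from the sequents themselves.
-- Sequents are preordered by S ≼ S': a monotone map of components along which
-- every formula occurrence of S survives in S', either literally or already
-- decomposed by the rule that introduces it. All premises of a rule lie above its
-- conclusion, so a consumed principal formula is never needed again, and neither
-- contraction nor weakening of LNIF is used. Formulae are interpreted as stable
-- predicates on pairs (sequent, component), with derivability as falsum; the
-- components of a sequent are linearly ordered and share one domain of
-- parameters, which validates (A ⊃ B) ∨ (B ⊃ A) and the ∀∨ axiom. A formula on
-- the left is true in the model (reflect), and a true formula on the right makes
-- the sequent derivable (reify).

module Submission where

open import Defs
open import Data.Bool using (true; false; if_then_else_; T)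
open import Data.Bool.Properties using (if-float)
open import Data.Empty using (⊥)
open import Data.Fin using (Fin; zero; suc; _≤_)
open import Data.Fin.Properties using (≤-refl; ≤-trans; ≤-total)
open import Data.List using (List; []; _∷_; _++_; _ʳ++_; reverse; length; lookup; map)
open import Data.List.Membership.Propositional using (_∈_)
open import Data.List.Membership.Propositional.Properties using (∈-∃++)
open import Data.List.Properties using (ʳ++-defn; map-cong; map-∘; map-cong-local; map-id-local)
open import Data.List.Relation.Binary.Permutation.Propositional
  using (_↭_; ↭-refl; ↭-sym)
open import Data.List.Relation.Binary.Permutation.Propositional.Properties
  using (∈-resp-↭; shift)
open import Data.List.Relation.Binary.Subset.Propositional using (_⊆_)
import Data.List.Relation.Unary.All as All
open import Data.List.Relation.Unary.Any using (Any; here; there)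
open import Data.Nat as ℕ using (ℕ; z≤n; s≤s; _≡ᵇ_)
import Data.Nat.Properties as ℕ
open import Data.Product using (_×_; _,_; proj₁; ∃-syntax)
open import Data.Sum as Sum using (_⊎_; inj₁; inj₂)
open import Function using (_∘_; case_of_)
open import Relation.Nullary.Decidable using (dec-true; dec-false)
open import Relation.Nullary using (¬_)
open import Relation.Binary.PropositionalEquality
  using (_≡_; _≢_; refl; sym; trans; cong; cong₂; subst)

private variable
  S S' S'' : LNS
  Γ Γ' Γ₀ Δ Δ' Δ₀ : List SFm
  A B : SFm
  x : ℕ

-- Positions, decomposed occurrences, and the preorder of sequents.

Pos : LNS → Set
Pos S = Fin (length S)

antecedent succedent : (S : LNS) → Pos S → List SFm
antecedent S i = Comp.ant (lookup S i)
succedent  S i = Comp.suc (lookup S i)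

-- Forcing by decomposition: Left grows and Right shrinks along the order of
-- components, as truth and falsity do in a Kripke chain.
data Left (S : LNS) (i : Pos S) : SFm → Set where
  occ  : ∀ {k} → A ∈ antecedent S k → k ≤ i → Left S i A
  and  : Left S i A → Left S i B → Left S i (A ∧' B)
  or₁  : Left S i A → Left S i (A ∨' B)
  or₂  : Left S i B → Left S i (A ∨' B)
  imp  : Left S i B → Left S i (A ⊃ B)
  some : ∀ a → Left S i (A [ a /p x ]) → Left S i (ex x A)

-- Since ∀l and ∃r keep their principal formula, `all` on the left and `ex` on the right have
-- literal occurrences only; likewise one premise of ⊃l keeps `A ⊃ B`, so only `B` decomposes it
-- there. `imp` and `every` may refer to a later component, where the right rules for implication
-- and ∀ open a new one.
data Right (S : LNS) (i : Pos S) : SFm → Set where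
  occ   : ∀ {k} → A ∈ succedent S k → i ≤ k → Right S i A
  and₁  : Right S i A → Right S i (A ∧' B)
  and₂  : Right S i B → Right S i (A ∧' B)
  or    : Right S i A → Right S i B → Right S i (A ∨' B)
  imp   : ∀ {j} → i ≤ j → Left S j A → Right S j B → Right S i (A ⊃ B)
  every : ∀ {j} a → i ≤ j → Right S j (A [ a /p x ]) → Right S i (all x A)

Left-up : ∀ {i j} → i ≤ j → Left S i A → Left S j A
Left-up i≤j (occ A∈ k≤i) = occ A∈ (≤-trans k≤i i≤j)
Left-up i≤j (and l l')   = and (Left-up i≤j l) (Left-up i≤j l')
Left-up i≤j (or₁ l)      = or₁ (Left-up i≤j l)
Left-up i≤j (or₂ l)      = or₂ (Left-up i≤j l)
Left-up i≤j (imp l)      = imp (Left-up i≤j l)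
Left-up i≤j (some a l)   = some a (Left-up i≤j l)

Right-down : ∀ {i j} → i ≤ j → Right S j A → Right S i A
Right-down i≤j (occ A∈ j≤k)    = occ A∈ (≤-trans i≤j j≤k)
Right-down i≤j (and₁ r)        = and₁ (Right-down i≤j r)
Right-down i≤j (and₂ r)        = and₂ (Right-down i≤j r)
Right-down i≤j (or r r')       = or (Right-down i≤j r) (Right-down i≤j r')
Right-down i≤j (imp j≤k l r)   = imp (≤-trans i≤j j≤k) l r
Right-down i≤j (every a j≤k r) = every a (≤-trans i≤j j≤k) r

infix 4 _≼_
record _≼_ (S S' : LNS) : Set where
  field
    to      : Pos S → Pos S'
    to-mono : ∀ {i j} → i ≤ j → to i ≤ to j
    left    : ∀ i → A ∈ antecedent S i → Left S' (to i) A
    right   : ∀ i → A ∈ succedent S i → Right S' (to i) A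
open _≼_

-- The field `left` speaks of literal occurrences only; induction on the decomposition carries it to
-- all of `Left`. Together with `Right-≼` this makes `≼` transitive.
Left-≼ : ∀ {i} (m : S ≼ S') → Left S i A → Left S' (to m i) A
Left-≼ m (occ A∈ k≤i) = Left-up (to-mono m k≤i) (left m _ A∈)
Left-≼ m (and l l')   = and (Left-≼ m l) (Left-≼ m l')
Left-≼ m (or₁ l)      = or₁ (Left-≼ m l)
Left-≼ m (or₂ l)      = or₂ (Left-≼ m l)
Left-≼ m (imp l)      = imp (Left-≼ m l)
Left-≼ m (some a l)   = some a (Left-≼ m l)

Right-≼ : ∀ {i} (m : S ≼ S') → Right S i A → Right S' (to m i) A
Right-≼ m (occ A∈ i≤k)    = Right-down (to-mono m i≤k) (right m _ A∈)
Right-≼ m (and₁ r)        = and₁ (Right-≼ m r)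
Right-≼ m (and₂ r)        = and₂ (Right-≼ m r)
Right-≼ m (or r r')       = or (Right-≼ m r) (Right-≼ m r')
Right-≼ m (imp i≤j l r)   = imp (to-mono m i≤j) (Left-≼ m l) (Right-≼ m r)
Right-≼ m (every a i≤j r) = every a (to-mono m i≤j) (Right-≼ m r)

≼-refl : S ≼ S
≼-refl = record
  { to = λ i → i ; to-mono = λ i≤j → i≤j
  ; left = λ _ A∈ → occ A∈ ≤-refl ; right = λ _ A∈ → occ A∈ ≤-refl }

infixr 9 _⨟_
_⨟_ : S ≼ S' → S' ≼ S'' → S ≼ S''
m ⨟ n = record
  { to = to n ∘ to m ; to-mono = to-mono n ∘ to-mono m
  ; left = λ i → Left-≼ n ∘ left m i ; right = λ i → Right-≼ n ∘ right m i }

skip : ∀ c → S ≼ (c ∷ S)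
skip c = record
  { to = suc ; to-mono = s≤s
  ; left = λ _ A∈ → occ A∈ ≤-refl ; right = λ _ A∈ → occ A∈ ≤-refl }

-- The tail may change as well, so this covers replacing, inserting and pushing
-- to the next component.
extend : S ≼ S' →
         (∀ {A} → A ∈ Γ → Left ((Γ' ⊢ Δ') ∷ S') zero A) →
         (∀ {A} → A ∈ Δ → Right ((Γ' ⊢ Δ') ∷ S') zero A) →
         ((Γ ⊢ Δ) ∷ S) ≼ ((Γ' ⊢ Δ') ∷ S')
extend {S} {S'} {Γ' = Γ'} {Δ' = Δ'} m l r = record
  { to = to' ; to-mono = λ {i} {j} → mono' i j ; left = left' ; right = right' }
  where
  to' : Fin (ℕ.suc (length S)) → Fin (ℕ.suc (length S'))
  to' zero    = zero
  to' (suc i) = suc (to m i)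
  mono' : ∀ i j → i ≤ j → to' i ≤ to' j
  mono' zero    j       _         = z≤n
  mono' (suc i) (suc j) (s≤s i≤j) = s≤s (to-mono m i≤j)
  left' : ∀ {A} i → A ∈ antecedent (_ ∷ S) i → Left ((Γ' ⊢ Δ') ∷ S') (to' i) A
  left' zero    = l
  left' (suc i) = Left-≼ (skip _) ∘ left m i
  right' : ∀ {A} i → A ∈ succedent (_ ∷ S) i → Right ((Γ' ⊢ Δ') ∷ S') (to' i) A
  right' zero    = r
  right' (suc i) = Right-≼ (skip _) ∘ right m i

occˡ : A ∈ Γ → Left ((Γ ⊢ Δ) ∷ S) zero A
occˡ A∈ = occ A∈ z≤n

occʳ : A ∈ Δ → Right ((Γ ⊢ Δ) ∷ S) zero A
occʳ A∈ = occ {k = zero} A∈ z≤n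

-- Serves rules that consume `A`: the side formulae survive literally, and `l` records how the
-- premise decomposes `A`.
replaceˡ : Γ ↭ A ∷ Γ₀ → Γ₀ ⊆ Γ' → Left ((Γ' ⊢ Δ) ∷ S) zero A →
           ∀ {B} → B ∈ Γ → Left ((Γ' ⊢ Δ) ∷ S) zero B
replaceˡ p Γ₀⊆ l B∈ with ∈-resp-↭ p B∈
... | here refl = l
... | there B∈₀ = occˡ (Γ₀⊆ B∈₀)

replaceʳ : Δ ↭ A ∷ Δ₀ → Δ₀ ⊆ Δ' → Right ((Γ ⊢ Δ') ∷ S) zero A →
           ∀ {B} → B ∈ Δ → Right ((Γ ⊢ Δ') ∷ S) zero B
replaceʳ p Δ₀⊆ r B∈ with ∈-resp-↭ p B∈
... | here refl = r
... | there B∈₀ = occʳ (Δ₀⊆ B∈₀)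

extract : A ∈ Γ → ∃[ Γ₀ ] Γ ↭ A ∷ Γ₀
extract A∈ with ∈-∃++ A∈
... | Γ₁ , Γ₂ , refl = Γ₁ ++ Γ₂ , shift _ Γ₁ Γ₂

-- Fresh parameters, from upper bounds on those that occur.

Bounded : (ℕ → Set) → Set
Bounded P = ∃[ n ] (∀ {a} → P a → a ℕ.< n)

bounded-⊎ : ∀ {P Q} → Bounded P → Bounded Q → Bounded (λ a → P a ⊎ Q a)
bounded-⊎ (m , p) (n , q) = m ℕ.⊔ n , Sum.[ (λ h → ℕ.<-≤-trans (p h) (ℕ.m≤m⊔n m n))
                                        , (λ h → ℕ.<-≤-trans (q h) (ℕ.m≤n⊔m m n)) ]

bounded-Any : ∀ {X : Set} {P : ℕ → X → Set} → (∀ y → Bounded (λ a → P a y)) →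
              ∀ ys → Bounded (λ a → Any (P a) ys)
bounded-Any b []       = 0 , λ ()
bounded-Any b (y ∷ ys) with bounded-⊎ (b y) (bounded-Any b ys)
... | n , h = n , λ { (here p) → h (inj₁ p) ; (there p) → h (inj₂ p) }

ParIn-bounded : ∀ A → Bounded (λ a → ParIn a A)
ParIn-bounded (atom p ts) = bounded-Any par-bounded ts
  where
  par-bounded : ∀ t → Bounded (λ a → par a ≡ t)
  par-bounded (var z) = 0 , λ ()
  par-bounded (par b) = ℕ.suc b , λ { refl → ℕ.≤-refl }
ParIn-bounded ⊥'        = 0 , λ ()
ParIn-bounded (A ∧' B)  = bounded-⊎ (ParIn-bounded A) (ParIn-bounded B)
ParIn-bounded (A ∨' B)  = bounded-⊎ (ParIn-bounded A) (ParIn-bounded B)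
ParIn-bounded (A ⊃ B)   = bounded-⊎ (ParIn-bounded A) (ParIn-bounded B)
ParIn-bounded (all z A) = ParIn-bounded A
ParIn-bounded (ex z A)  = ParIn-bounded A

fresh : ∀ S → ∃[ a ] ¬ ParInLNS a S
fresh S with bounded-Any (λ c → bounded-⊎ (bounded-Any ParIn-bounded (Comp.ant c))
                                          (bounded-Any ParIn-bounded (Comp.suc c))) S
... | n , bound = n , λ h → ℕ.<-irrefl refl (bound h)

-- The rules at an arbitrary position.

-- The prefix is kept reversed, so that D (c ∷ G) S and D G (c ∷ S) are the same type.
D : LNS → LNS → Set
D G S = LNIF (G ʳ++ S)

zip : ∀ G → LNIF (reverse G ++ S) → D G S
zip G = subst LNIF (sym (ʳ++-defn G))

unzip : ∀ G → D G S → LNIF (reverse G ++ S)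
unzip G = subst LNIF (ʳ++-defn G)

permˡ : ∀ G → Γ ↭ Γ' → LNIF (reverse G ++ (Γ' ⊢ Δ) ∷ S) → D G ((Γ ⊢ Δ) ∷ S)
permˡ G p d = zip G (perm {G = reverse G} (↭-sym p) ↭-refl d)

permʳ : ∀ G → Δ ↭ Δ' → LNIF (reverse G ++ (Γ ⊢ Δ') ∷ S) → D G ((Γ ⊢ Δ) ∷ S)
permʳ G p d = zip G (perm {G = reverse G} ↭-refl (↭-sym p) d)

cons : ∀ c → S ≼ S' → (c ∷ S) ≼ (c ∷ S')
cons c m = extend m occˡ occʳ

sucˡ : ∀ {c i} → Left S i A → Left (c ∷ S) (suc i) A
sucˡ = Left-≼ (skip _)

sucʳ : ∀ {c i} → Right S i A → Right (c ∷ S) (suc i) A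
sucʳ = Right-≼ (skip _)

-- Here and below, recursion on the position moves components into the prefix until the one with the
-- principal formula comes first.
⊥-left : ∀ G S k → ⊥' ∈ antecedent S k → D G S
⊥-left G (c ∷ S) (suc k) ⊥∈ = ⊥-left (c ∷ G) S k ⊥∈
⊥-left G (c ∷ S) zero    ⊥∈ with extract ⊥∈
... | Γ₀ , p = permˡ G p (⊥l {G = reverse G})

lift-next : ∀ G {c Γ Δ} → A ∈ Comp.ant c →
            D G (c ∷ (A ∷ Γ ⊢ Δ) ∷ S) → D G (c ∷ (Γ ⊢ Δ) ∷ S)
lift-next G A∈ d with extract A∈
... | Γ₀ , p = permˡ G p (lift {G = reverse G} (perm {G = reverse G} p ↭-refl (unzip G d)))

-- `lift` carries the atom from component to component until it meets its occurrence on the right,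
-- where id₁ applies.
identity₀ : ∀ G c S j {p ts} → atom p ts ∈ Comp.ant c → atom p ts ∈ succedent (c ∷ S) j →
            D G (c ∷ S)
identity₀ G c S zero l r with extract l | extract r
... | Γ₀ , p | Δ₀ , q = zip G (perm {G = reverse G} (↭-sym p) (↭-sym q) (id₁ {G = reverse G} _ _))
-- Lifting changes only the antecedent of `d`; splitting the index once more lets `succedent`
-- compute before and after the change.
identity₀ G c (d ∷ S) (suc zero) l r =
  lift-next G l (identity₀ (c ∷ G) _ S zero (here refl) r)
identity₀ G c (d ∷ S) (suc (suc j)) l r =
  lift-next G l (identity₀ (c ∷ G) _ S (suc j) (here refl) r)

identity : ∀ G S k j {p ts} → atom p ts ∈ antecedent S k → atom p ts ∈ succedent S j →
           k ≤ j → D G S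
identity G (c ∷ S) zero    j       l r _         = identity₀ G c S j l r
identity G (c ∷ S) (suc k) (suc j) l r (s≤s k≤j) = identity (c ∷ G) S k j l r k≤j

-- The rules are put in continuation form: `κ` derives each premise, given an embedding of the
-- conclusion into it and the subformulae that the rule exposes.
∧-left : ∀ G S k → (A ∧' B) ∈ antecedent S k →
         (∀ {S'} (m : S ≼ S') → Left S' (to m k) A → Left S' (to m k) B → D G S') → D G S
∧-left G (c ∷ S) (suc k) A∧B∈ κ =
  ∧-left (c ∷ G) S k A∧B∈ λ m l l' → κ (cons c m) (sucˡ l) (sucˡ l')
∧-left G (c ∷ S) zero A∧B∈ κ with extract A∧B∈
... | Γ₀ , p = permˡ G p (∧l {G = reverse G} (unzip G
  (κ (extend ≼-refl (replaceˡ p (there ∘ there) (and l l')) occʳ) l l')))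
  where
  l  = occˡ (here refl)
  l' = occˡ (there (here refl))

∨-left : ∀ G S k → (A ∨' B) ∈ antecedent S k →
         (∀ {S'} (m : S ≼ S') → Left S' (to m k) A ⊎ Left S' (to m k) B → D G S') → D G S
∨-left G (c ∷ S) (suc k) A∨B∈ κ =
  ∨-left (c ∷ G) S k A∨B∈ λ m l → κ (cons c m) (Sum.map sucˡ sucˡ l)
∨-left G (c ∷ S) zero A∨B∈ κ with extract A∨B∈
... | Γ₀ , p = permˡ G p (∨l {G = reverse G}
  (unzip G (κ (extend ≼-refl (replaceˡ p there (or₁ l)) occʳ) (inj₁ l)))
  (unzip G (κ (extend ≼-refl (replaceˡ p there (or₂ l')) occʳ) (inj₂ l'))))
  where
  l  = occˡ (here refl)
  l' = occˡ (here refl)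

∀-left : ∀ G S k a → all x A ∈ antecedent S k →
         (∀ {S'} (m : S ≼ S') → Left S' (to m k) (A [ a /p x ]) → D G S') → D G S
∀-left G (c ∷ S) (suc k) a ∀A∈ κ =
  ∀-left (c ∷ G) S k a ∀A∈ λ m l → κ (cons c m) (sucˡ l)
∀-left G (c ∷ S) zero a ∀A∈ κ with extract ∀A∈
... | Γ₀ , p = permˡ G p (∀l {G = reverse G} a (unzip G
  (κ (extend ≼-refl (occˡ ∘ there ∘ ∈-resp-↭ p) occʳ) (occˡ (here refl)))))

∃-left : ∀ G S k → ex x A ∈ antecedent S k →
         (∀ {S'} (m : S ≼ S') a → Left S' (to m k) (A [ a /p x ]) → D G S') → D G S
∃-left G (c ∷ S) (suc k) ∃A∈ κ =
  ∃-left (c ∷ G) S k ∃A∈ λ m a l → κ (cons c m) a (sucˡ l)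
∃-left G ((Γ ⊢ Δ) ∷ S) zero ∃A∈ κ with extract ∃A∈
... | Γ₀ , p with fresh (reverse G ++ (_ ∷ Γ₀ ⊢ Δ) ∷ S)
... | a , a∉ = permˡ G p (∃l {G = reverse G} a a∉ (unzip G
  (κ (extend ≼-refl (replaceˡ p there (some a l)) occʳ) a l)))
  where l = occˡ (here refl)

-- An implication acts at every later component, so `lift` first copies it to position `i`, and ⊃l
-- is applied to the copy.
⊃-left₀ : ∀ G c S i → (A ⊃ B) ∈ Comp.ant c →
          (∀ {S'} (m : (c ∷ S) ≼ S') → Left S' (to m i) B ⊎ Right S' (to m i) A → D G S') →
          D G (c ∷ S)
⊃-left₀ G c S zero A⊃B∈ κ with extract A⊃B∈
... | Γ₀ , p = permˡ G p (⊃l {G = reverse G}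
  (unzip G (κ (extend ≼-refl (replaceˡ p there (imp l)) occʳ) (inj₁ l)))
  (unzip G (κ (extend ≼-refl (occˡ ∘ ∈-resp-↭ p) (occʳ ∘ there)) (inj₂ (occʳ (here refl))))))
  where l = occˡ (here refl)
⊃-left₀ {A = A} {B = B} G c (d ∷ S) (suc i) A⊃B∈ κ = lift-next G A⊃B∈
  (⊃-left₀ (c ∷ G) _ S (to w i) (here refl) λ m s → κ (cons c (w ⨟ m)) (Sum.map sucˡ sucʳ s))
  where
  w : (d ∷ S) ≼ (((A ⊃ B) ∷ Comp.ant d ⊢ Comp.suc d) ∷ S)
  w = extend ≼-refl (occˡ ∘ there) occʳ

⊃-left : ∀ G S k i → (A ⊃ B) ∈ antecedent S k → k ≤ i →
         (∀ {S'} (m : S ≼ S') → Left S' (to m i) B ⊎ Right S' (to m i) A → D G S') → D G S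
⊃-left G (c ∷ S) zero    i       A⊃B∈ _         κ = ⊃-left₀ G c S i A⊃B∈ κ
⊃-left G (c ∷ S) (suc k) (suc i) A⊃B∈ (s≤s k≤i) κ =
  ⊃-left (c ∷ G) S k i A⊃B∈ k≤i λ m s → κ (cons c m) (Sum.map sucˡ sucʳ s)

∧-right : ∀ G S k → (A ∧' B) ∈ succedent S k →
          (∀ {S'} (m : S ≼ S') → Right S' (to m k) A ⊎ Right S' (to m k) B → D G S') → D G S
∧-right G (c ∷ S) (suc k) A∧B∈ κ =
  ∧-right (c ∷ G) S k A∧B∈ λ m r → κ (cons c m) (Sum.map sucʳ sucʳ r)
∧-right G (c ∷ S) zero A∧B∈ κ with extract A∧B∈
... | Δ₀ , p = permʳ G p (∧r {G = reverse G}
  (unzip G (κ (extend ≼-refl occˡ (replaceʳ p there (and₁ r))) (inj₁ r)))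
  (unzip G (κ (extend ≼-refl occˡ (replaceʳ p there (and₂ r'))) (inj₂ r'))))
  where
  r  = occʳ (here refl)
  r' = occʳ (here refl)

∨-right : ∀ G S k → (A ∨' B) ∈ succedent S k →
          (∀ {S'} (m : S ≼ S') → Right S' (to m k) A → Right S' (to m k) B → D G S') → D G S
∨-right G (c ∷ S) (suc k) A∨B∈ κ =
  ∨-right (c ∷ G) S k A∨B∈ λ m r r' → κ (cons c m) (sucʳ r) (sucʳ r')
∨-right G (c ∷ S) zero A∨B∈ κ with extract A∨B∈
... | Δ₀ , p = permʳ G p (∨r {G = reverse G} (unzip G
  (κ (extend ≼-refl occˡ (replaceʳ p (there ∘ there) (or r r'))) r r')))
  where
  r  = occʳ (here refl)
  r' = occʳ (there (here refl))

∃-right : ∀ G S k a → ex x A ∈ succedent S k →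
          (∀ {S'} (m : S ≼ S') → Right S' (to m k) (A [ a /p x ]) → D G S') → D G S
∃-right G (c ∷ S) (suc k) a ∃A∈ κ =
  ∃-right (c ∷ G) S k a ∃A∈ λ m r → κ (cons c m) (sucʳ r)
∃-right G (c ∷ S) zero a ∃A∈ κ with extract ∃A∈
... | Δ₀ , p = permʳ G p (∃r {G = reverse G} a (unzip G
  (κ (extend ≼-refl occˡ (occʳ ∘ there ∘ ∈-resp-↭ p)) (occʳ (here refl)))))

insert : Δ ↭ A ∷ Δ₀ → Right ((Γ ⊢ Δ₀) ∷ S') zero A → S ≼ S' →
         ((Γ ⊢ Δ) ∷ S) ≼ ((Γ ⊢ Δ₀) ∷ S')
insert p r m = extend m occˡ (replaceʳ p (λ B∈ → B∈) r)

-- The second premise of ⊃r₂ and ∀r₂ moves the principal formula one component onwards. An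
-- occurrence there still counts as `Right` at the old place.
push : ∀ {d} → Δ ↭ A ∷ Δ₀ →
       ((Γ ⊢ Δ) ∷ d ∷ S) ≼ ((Γ ⊢ Δ₀) ∷ (Comp.ant d ⊢ A ∷ Comp.suc d) ∷ S)
push p = insert p (Right-down z≤n (sucʳ (occʳ (here refl)))) (extend ≼-refl occˡ (occʳ ∘ there))

-- Recursion on the tail. At the last component ⊃r₁ suffices; otherwise ⊃r₂ yields one premise with
-- a new component, which `κ` derives, and one with the formula pushed onwards, which the recursive
-- call derives.
⊃-right₀ : ∀ G c S → (A ⊃ B) ∈ Comp.suc c →
           (∀ {S'} (m : (c ∷ S) ≼ S') j → to m zero ≤ j →
              Left S' j A → Right S' j B → D G S') →
           D G (c ∷ S)
⊃-right₀ {A = A} {B = B} G (Γ ⊢ Δ) S A⊃B∈ κ with extract A⊃B∈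
... | Δ₀ , p = permʳ G p (rule S κ)
  where
  premise : ∀ S → (∀ {S'} (m : ((Γ ⊢ Δ) ∷ S) ≼ S') j → to m zero ≤ j →
                     Left S' j A → Right S' j B → D G S') →
            D G ((Γ ⊢ Δ₀) ∷ (A ∷ [] ⊢ B ∷ []) ∷ S)
  -- The new component, at index one, itself witnesses that `A ⊃ B` survives at its old place.
  premise S κ = κ (insert p (imp {j = suc zero} z≤n l r) (skip _)) (suc zero) z≤n l r
    where
    l = sucˡ (occˡ (here refl))
    r = sucʳ (occʳ (here refl))
  rule : ∀ S → (∀ {S'} (m : ((Γ ⊢ Δ) ∷ S) ≼ S') j → to m zero ≤ j →
                  Left S' j A → Right S' j B → D G S') →
         LNIF (reverse G ++ (Γ ⊢ (A ⊃ B) ∷ Δ₀) ∷ S)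
  rule []      κ = ⊃r₁ {G = reverse G} (unzip G (premise [] κ))
  rule (d ∷ S) κ = ⊃r₂ {G = reverse G} (unzip G (premise (d ∷ S) κ))
    (unzip G (⊃-right₀ ((Γ ⊢ Δ₀) ∷ G) _ S (here refl)
      λ m j _ l r → κ (push p ⨟ cons _ m) (suc j) z≤n (sucˡ l) (sucʳ r)))

⊃-right : ∀ G S k → (A ⊃ B) ∈ succedent S k →
          (∀ {S'} (m : S ≼ S') j → to m k ≤ j → Left S' j A → Right S' j B → D G S') → D G S
⊃-right G (c ∷ S) zero    A⊃B∈ κ = ⊃-right₀ G c S A⊃B∈ κ
⊃-right G (c ∷ S) (suc k) A⊃B∈ κ =
  ⊃-right (c ∷ G) S k A⊃B∈ λ m j le l r → κ (cons c m) (suc j) (s≤s le) (sucˡ l) (sucʳ r)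

-- The same recursion as for implication, with an eigenvariable chosen afresh at every component
-- passed.
∀-right₀ : ∀ G c S → all x A ∈ Comp.suc c →
           (∀ {S'} (m : (c ∷ S) ≼ S') j a → to m zero ≤ j → Right S' j (A [ a /p x ]) → D G S') →
           D G (c ∷ S)
∀-right₀ {x = x} {A = A} G (Γ ⊢ Δ) S ∀A∈ κ with extract ∀A∈
... | Δ₀ , p = permʳ G p (rule S κ)
  where
  premise : ∀ S a → (∀ {S'} (m : ((Γ ⊢ Δ) ∷ S) ≼ S') j a → to m zero ≤ j →
                       Right S' j (A [ a /p x ]) → D G S') →
            D G ((Γ ⊢ Δ₀) ∷ ([] ⊢ (A [ a /p x ]) ∷ []) ∷ S)
  premise S a κ = κ (insert p (every {j = suc zero} a z≤n r) (skip _)) (suc zero) a z≤n r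
    where r = sucʳ (occʳ (here refl))
  rule : ∀ S → (∀ {S'} (m : ((Γ ⊢ Δ) ∷ S) ≼ S') j a → to m zero ≤ j →
                  Right S' j (A [ a /p x ]) → D G S') →
         LNIF (reverse G ++ (Γ ⊢ all x A ∷ Δ₀) ∷ S)
  rule S κ with fresh (reverse G ++ (Γ ⊢ all x A ∷ Δ₀) ∷ S)
  rule []      κ | a , a∉ = ∀r₁ {G = reverse G} a a∉ (unzip G (premise [] a κ))
  rule (d ∷ S) κ | a , a∉ = ∀r₂ {G = reverse G} a a∉ (unzip G (premise (d ∷ S) a κ))
    (unzip G (∀-right₀ ((Γ ⊢ Δ₀) ∷ G) _ S (here refl)
      λ m j a _ r → κ (push p ⨟ cons _ m) (suc j) a z≤n (sucʳ r)))

∀-right : ∀ G S k → all x A ∈ succedent S k →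
          (∀ {S'} (m : S ≼ S') j a → to m k ≤ j → Right S' j (A [ a /p x ]) → D G S') → D G S
∀-right G (c ∷ S) zero    ∀A∈ κ = ∀-right₀ G c S ∀A∈ κ
∀-right G (c ∷ S) (suc k) ∀A∈ κ =
  ∀-right (c ∷ G) S k ∀A∈ λ m j a le r → κ (cons c m) (suc j) a (s≤s le) (sucʳ r)

-- The rules for decomposed occurrences.

use-⊥ˡ : ∀ {i} → Left S i ⊥' → LNIF S
use-⊥ˡ (occ ⊥∈ _) = ⊥-left [] _ _ ⊥∈

use-atom : ∀ {i p ts} → Left S i (atom p ts) → Right S i (atom p ts) → LNIF S
use-atom (occ l k≤i) (occ r i≤j) = identity [] _ _ _ l r (≤-trans k≤i i≤j)

-- A decomposed formula hands over its parts along the identity embedding; only a literal occurrence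
-- calls for the rule. The same holds for the other connectives.
use-∧ˡ : ∀ {i} → Left S i (A ∧' B) →
         (∀ {S'} (m : S ≼ S') → Left S' (to m i) A → Left S' (to m i) B → LNIF S') → LNIF S
use-∧ˡ (and l l')   κ = κ ≼-refl l l'
use-∧ˡ (occ A∈ k≤i) κ = ∧-left [] _ _ A∈ λ m l l' →
  κ m (Left-up (to-mono m k≤i) l) (Left-up (to-mono m k≤i) l')

use-∨ˡ : ∀ {i} → Left S i (A ∨' B) →
         (∀ {S'} (m : S ≼ S') → Left S' (to m i) A ⊎ Left S' (to m i) B → LNIF S') → LNIF S
use-∨ˡ (or₁ l)      κ = κ ≼-refl (inj₁ l)
use-∨ˡ (or₂ l)      κ = κ ≼-refl (inj₂ l)
use-∨ˡ (occ A∈ k≤i) κ = ∨-left [] _ _ A∈ λ m l →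
  κ m (Sum.map (Left-up (to-mono m k≤i)) (Left-up (to-mono m k≤i)) l)

use-⊃ˡ : ∀ {i} → Left S i (A ⊃ B) →
         (∀ {S'} (m : S ≼ S') → Left S' (to m i) B ⊎ Right S' (to m i) A → LNIF S') → LNIF S
use-⊃ˡ (imp l)      κ = κ ≼-refl (inj₁ l)
use-⊃ˡ (occ A∈ k≤i) κ = ⊃-left [] _ _ _ A∈ k≤i κ

use-∀ˡ : ∀ {i} a → Left S i (all x A) →
         (∀ {S'} (m : S ≼ S') → Left S' (to m i) (A [ a /p x ]) → LNIF S') → LNIF S
use-∀ˡ a (occ A∈ k≤i) κ = ∀-left [] _ _ a A∈ λ m l → κ m (Left-up (to-mono m k≤i) l)

use-∃ˡ : ∀ {i} → Left S i (ex x A) →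
         (∀ {S'} (m : S ≼ S') a → Left S' (to m i) (A [ a /p x ]) → LNIF S') → LNIF S
use-∃ˡ (some a l)   κ = κ ≼-refl a l
use-∃ˡ (occ A∈ k≤i) κ = ∃-left [] _ _ A∈ λ m a l → κ m a (Left-up (to-mono m k≤i) l)

use-∧ʳ : ∀ {i} → Right S i (A ∧' B) →
         (∀ {S'} (m : S ≼ S') → Right S' (to m i) A ⊎ Right S' (to m i) B → LNIF S') → LNIF S
use-∧ʳ (and₁ r)     κ = κ ≼-refl (inj₁ r)
use-∧ʳ (and₂ r)     κ = κ ≼-refl (inj₂ r)
use-∧ʳ (occ A∈ i≤k) κ = ∧-right [] _ _ A∈ λ m r →
  κ m (Sum.map (Right-down (to-mono m i≤k)) (Right-down (to-mono m i≤k)) r)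

use-∨ʳ : ∀ {i} → Right S i (A ∨' B) →
         (∀ {S'} (m : S ≼ S') → Right S' (to m i) A → Right S' (to m i) B → LNIF S') → LNIF S
use-∨ʳ (or r r')    κ = κ ≼-refl r r'
use-∨ʳ (occ A∈ i≤k) κ = ∨-right [] _ _ A∈ λ m r r' →
  κ m (Right-down (to-mono m i≤k) r) (Right-down (to-mono m i≤k) r')

use-⊃ʳ : ∀ {i} → Right S i (A ⊃ B) →
         (∀ {S'} (m : S ≼ S') j → to m i ≤ j → Left S' j A → Right S' j B → LNIF S') → LNIF S
use-⊃ʳ (imp i≤j l r) κ = κ ≼-refl _ i≤j l r
use-⊃ʳ (occ A∈ i≤k)  κ = ⊃-right [] _ _ A∈ λ m j le → κ m j (≤-trans (to-mono m i≤k) le)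

use-∀ʳ : ∀ {i} → Right S i (all x A) →
         (∀ {S'} (m : S ≼ S') j a → to m i ≤ j → Right S' j (A [ a /p x ]) → LNIF S') → LNIF S
use-∀ʳ (every a i≤j r) κ = κ ≼-refl _ a i≤j r
use-∀ʳ (occ A∈ i≤k)    κ = ∀-right [] _ _ A∈ λ m j a le → κ m j a (≤-trans (to-mono m i≤k) le)

use-∃ʳ : ∀ {i} a → Right S i (ex x A) →
         (∀ {S'} (m : S ≼ S') → Right S' (to m i) (A [ a /p x ]) → LNIF S') → LNIF S
use-∃ʳ a (occ A∈ i≤k) κ = ∃-right [] _ _ a A∈ λ m r → κ m (Right-down (to-mono m i≤k) r)

-- Truth values and the interpretation of formulae.

-- Derivability plays the role of falsum, and stability is closure under the
-- resulting double negation.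
Refutes : (∀ S → Pos S → Set) → ∀ S → Pos S → Set
Refutes P S i = ∀ {S'} (m : S ≼ S') → P S' (to m i) → LNIF S'

-- Truth persists to larger sequents and to later components. The negation in `stable` extends the
-- sequent but keeps the component: reasoning is classical along `≼` and intuitionistic along the
-- chain of components.
record Val : Set₁ where
  field
    at     : ∀ S → Pos S → Set
    mono   : ∀ {i j} (m : S ≼ S') → to m i ≤ j → at S i → at S' j
    stable : ∀ {i} → (∀ {S'} (m : S ≼ S') → Refutes at S' (to m i) → LNIF S') → at S i
open Val

-- Being a negation, this is stable; `reify` at atoms is immediate, and `reflect` amounts to the
-- initial sequents.
atomᵛ : SFm → Val
atomᵛ A = record
  { at     = Refutes (λ S i → Right S i A)
  ; mono   = λ m le t n r → t (m ⨟ n) (Right-down (to-mono n le) r)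
  ; stable = λ h m r → h m λ n t → t ≼-refl (Right-≼ n r)
  }

⋀ : {I : Set} → (I → Val) → Val
⋀ X = record
  { at     = λ S i → ∀ ι → at (X ι) S i
  ; mono   = λ m le t ι → mono (X ι) m le (t ι)
  ; stable = λ h ι → stable (X ι) λ m k → h m λ n t → k n (t ι)
  }

-- The De Morgan form of the join, which is stable by construction. The empty index type gives
-- falsum.
⋁ : {I : Set} → (I → Val) → Val
⋁ {I} X = record
  { at     = λ S i → Refutes (λ S' j → ∀ ι → Refutes (at (X ι)) S' j) S i
  ; mono   = λ m le t n k → t (m ⨟ n) λ ι p a →
               k ι p (mono (X ι) ≼-refl (to-mono p (to-mono n le)) a)
  ; stable = λ h m k → h m λ n t → t ≼-refl λ ι p → k ι (n ⨟ p)
  }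

infixr 4 _⇒_
_⇒_ : Val → Val → Val
X ⇒ Y = record
  { at     = λ S i → ∀ {S'} (m : S ≼ S') {j} → to m i ≤ j → at X S' j → at Y S' j
  ; mono   = λ m le t n le' → t (m ⨟ n) (≤-trans (to-mono n le) le')
  ; stable = λ h m le a → stable Y λ n k → h (m ⨟ n) λ p t →
               k p (t ≼-refl (to-mono p (to-mono n le)) (mono X (n ⨟ p) ≤-refl a))
  }

infixl 7 _[_↦_]
_[_↦_] : (ℕ → ℕ) → ℕ → ℕ → ℕ → ℕ
(ρ [ x ↦ a ]) z = if z ≡ᵇ x then a else ρ z

⟦_⟧ : IFm → (ℕ → ℕ) → Val
⟦ atom p ts ⟧ ρ = atomᵛ (atom p (map (par ∘ ρ) ts))
⟦ ⊥' ⟧        ρ = ⋁ {⊥} λ ()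
⟦ A ∧' B ⟧    ρ = ⋀ λ b → if b then ⟦ A ⟧ ρ else ⟦ B ⟧ ρ
⟦ A ∨' B ⟧    ρ = ⋁ λ b → if b then ⟦ A ⟧ ρ else ⟦ B ⟧ ρ
⟦ A ⊃ B ⟧     ρ = ⟦ A ⟧ ρ ⇒ ⟦ B ⟧ ρ
⟦ all x A ⟧   ρ = ⋀ λ a → ⟦ A ⟧ (ρ [ x ↦ a ])
⟦ ex x A ⟧    ρ = ⋁ λ a → ⟦ A ⟧ (ρ [ x ↦ a ])

-- Translation into sequent formulae and instantiation by parameters.

translate : (ℕ → ℕ) → List ℕ → ℕ → Tm
translate ρ bs z = if member z bs then var z else par (ρ z)

bind-cong : ∀ {ρ ρ' bs bs' y} z → translate ρ bs z ≡ translate ρ' bs' z →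
            translate ρ (y ∷ bs) z ≡ translate ρ' (y ∷ bs') z
bind-cong {y = y} z eq with z ≡ᵇ y
... | true  = refl
... | false = eq

toSFm-cong : ∀ {ρ ρ' bs bs'} → (∀ z → translate ρ bs z ≡ translate ρ' bs' z) →
             ∀ A → toSFm ρ bs A ≡ toSFm ρ' bs' A
toSFm-cong eq (atom p ts) = cong (atom p) (map-cong eq ts)
toSFm-cong eq ⊥'          = refl
toSFm-cong eq (A ∧' B)    = cong₂ _∧'_ (toSFm-cong eq A) (toSFm-cong eq B)
toSFm-cong eq (A ∨' B)    = cong₂ _∨'_ (toSFm-cong eq A) (toSFm-cong eq B)
toSFm-cong eq (A ⊃ B)     = cong₂ _⊃_ (toSFm-cong eq A) (toSFm-cong eq B)
toSFm-cong {ρ} {ρ'} {bs} {bs'} eq (all y A) =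
  cong (all y) (toSFm-cong (λ z → bind-cong {ρ} {ρ'} {bs} {bs'} z (eq z)) A)
toSFm-cong {ρ} {ρ'} {bs} {bs'} eq (ex y A)  =
  cong (ex y) (toSFm-cong (λ z → bind-cong {ρ} {ρ'} {bs} {bs'} z (eq z)) A)

≡ᵇ-true : ∀ {z y} → (z ≡ᵇ y) ≡ true → z ≡ y
≡ᵇ-true {z} {y} eq = ℕ.≡ᵇ⇒≡ z y (subst T (sym eq) _)

≡ᵇ-false : ∀ {z y} → (z ≡ᵇ y) ≡ false → z ≢ y
≡ᵇ-false {z} {y} eq z≡y with () ← trans (sym eq) (dec-true (z ℕ.≟ y) z≡y)

substᵗ : ℕ → ℕ → Tm → Tm
substᵗ a x (var z) = if z ≡ᵇ x then par a else var z
substᵗ a x (par b) = par b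

module _ {ρ ρ' : ℕ → ℕ} {bs bs' : List ℕ} {a x y : ℕ} where

  -- A binder of `x` stops the substitution. At every other variable the substitution changes
  -- nothing, so the hypothesis becomes a plain equality.
  bind-capture : y ≡ x → ∀ z → substᵗ a x (translate ρ bs z) ≡ translate ρ' bs' z →
                 translate ρ (y ∷ bs) z ≡ translate ρ' (y ∷ bs') z
  bind-capture refl z eq with z ≡ᵇ y in z≡ᵇy
  ... | true  = refl
  ... | false with member z bs
  ... | true  rewrite z≡ᵇy = eq
  ... | false = eq

  bind-[/p] : y ≢ x → ∀ z → substᵗ a x (translate ρ bs z) ≡ translate ρ' bs' z →
              substᵗ a x (translate ρ (y ∷ bs) z) ≡ translate ρ' (y ∷ bs') z
  bind-[/p] y≢x z eq with z ≡ᵇ y in z≡ᵇy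
  ... | false = eq
  ... | true with refl ← ≡ᵇ-true {z} {y} z≡ᵇy rewrite dec-false (y ℕ.≟ x) y≢x = refl

-- A pointwise relation between arbitrary `bs` and `bs'` is what the induction can carry under
-- binders. `instantiate` is the case with `x` as the only bound variable.
toSFm-[/p] : ∀ {ρ ρ' bs bs' a x} → (∀ z → substᵗ a x (translate ρ bs z) ≡ translate ρ' bs' z) →
             ∀ A → (toSFm ρ bs A) [ a /p x ] ≡ toSFm ρ' bs' A
toSFm-[/p] {a = a} {x} eq (atom p ts) = cong (atom p)
  (trans (map-cong {g = substᵗ a x} (λ { (var _) → refl ; (par _) → refl }) _)
    (trans (sym (map-∘ ts)) (map-cong eq ts)))
toSFm-[/p] eq ⊥'          = refl
toSFm-[/p] eq (A ∧' B)    = cong₂ _∧'_ (toSFm-[/p] eq A) (toSFm-[/p] eq B)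
toSFm-[/p] eq (A ∨' B)    = cong₂ _∨'_ (toSFm-[/p] eq A) (toSFm-[/p] eq B)
toSFm-[/p] eq (A ⊃ B)     = cong₂ _⊃_ (toSFm-[/p] eq A) (toSFm-[/p] eq B)
toSFm-[/p] {ρ} {ρ'} {bs} {bs'} {x = x} eq (all y A) with y ≡ᵇ x in y≡ᵇx
... | true  = cong (all y)
  (toSFm-cong (λ z → bind-capture {ρ} {ρ'} {bs} {bs'} (≡ᵇ-true y≡ᵇx) z (eq z)) A)
... | false = cong (all y)
  (toSFm-[/p] (λ z → bind-[/p] {ρ} {ρ'} {bs} {bs'} (≡ᵇ-false y≡ᵇx) z (eq z)) A)
toSFm-[/p] {ρ} {ρ'} {bs} {bs'} {x = x} eq (ex y A) with y ≡ᵇ x in y≡ᵇx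
... | true  = cong (ex y)
  (toSFm-cong (λ z → bind-capture {ρ} {ρ'} {bs} {bs'} (≡ᵇ-true y≡ᵇx) z (eq z)) A)
... | false = cong (ex y)
  (toSFm-[/p] (λ z → bind-[/p] {ρ} {ρ'} {bs} {bs'} (≡ᵇ-false y≡ᵇx) z (eq z)) A)

instantiate : ∀ {ρ a x} A → (toSFm ρ (x ∷ []) A) [ a /p x ] ≡ A ′[ ρ [ x ↦ a ] ]
instantiate {ρ} {a} {x} = toSFm-[/p] {bs = x ∷ []} {[]} eq
  where
  eq : ∀ z → substᵗ a x (translate ρ (x ∷ []) z) ≡ par ((ρ [ x ↦ a ]) z)
  eq z with z ≡ᵇ x in z≡ᵇx
  ... | false = refl
  ... | true rewrite z≡ᵇx = refl

-- Comparison of occurrences with truth in the model.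

mutual
  -- Simultaneous induction on `A`; the two directions meet at implication, whose antecedent changes
  -- sides. Where `reflect` has to produce a truth, `stable` turns the goal into derivability, so
  -- that a left rule can be applied.
  reflect : ∀ A {ρ i} → Left S i (A ′[ ρ ]) → at (⟦ A ⟧ ρ) S i
  reflect (atom p ts) l m r = use-atom (Left-≼ m l) r
  reflect ⊥'          l m _ = use-⊥ˡ (Left-≼ m l)
  reflect (A ∧' B) {ρ} l true  = stable (⟦ A ⟧ ρ) λ m k →
    use-∧ˡ (Left-≼ m l) λ n l₁ _ → k n (reflect A l₁)
  reflect (A ∧' B) {ρ} l false = stable (⟦ B ⟧ ρ) λ m k →
    use-∧ˡ (Left-≼ m l) λ n _ l₂ → k n (reflect B l₂)
  reflect (A ∨' B) l m k = use-∨ˡ (Left-≼ m l) λ where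
    n (inj₁ l₁) → k true n (reflect A l₁)
    n (inj₂ l₂) → k false n (reflect B l₂)
  reflect (A ⊃ B) {ρ} l m le t = stable (⟦ B ⟧ ρ) λ n k →
    use-⊃ˡ (Left-up (to-mono n le) (Left-≼ (m ⨟ n) l)) λ where
      p (inj₁ l₂) → k p (reflect B l₂)
      p (inj₂ r₁) → reify A r₁ (mono (⟦ A ⟧ ρ) (n ⨟ p) ≤-refl t)
  reflect (all x A) {ρ} l a = stable (⟦ A ⟧ (ρ [ x ↦ a ])) λ m k →
    use-∀ˡ a (Left-≼ m l) λ n l₁ → k n (reflect A (subst (Left _ _) (instantiate A) l₁))
  reflect (ex x A) l m k =
    use-∃ˡ (Left-≼ m l) λ n a l₁ → k a n (reflect A (subst (Left _ _) (instantiate A) l₁))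

  reify : ∀ A {ρ i} → Right S i (A ′[ ρ ]) → at (⟦ A ⟧ ρ) S i → LNIF S
  reify (atom p ts) r t = t ≼-refl r
  reify ⊥'          r t = t ≼-refl λ ()
  reify (A ∧' B) {ρ} r t = use-∧ʳ r λ where
    m (inj₁ r₁) → reify A r₁ (mono (⟦ A ⟧ ρ) m ≤-refl (t true))
    m (inj₂ r₂) → reify B r₂ (mono (⟦ B ⟧ ρ) m ≤-refl (t false))
  reify (A ∨' B) r t = use-∨ʳ r λ m r₁ r₂ → t m λ where
    true  n → reify A (Right-≼ n r₁)
    false n → reify B (Right-≼ n r₂)
  reify (A ⊃ B) r t = use-⊃ʳ r λ m j le l₁ r₂ → reify B r₂ (t m le (reflect A l₁))
  reify (all x A) {ρ} r t = use-∀ʳ r λ m j a le r₁ →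
    reify A (subst (Right _ _) (instantiate A) r₁) (mono (⟦ A ⟧ (ρ [ x ↦ a ])) m le (t a))
  reify (ex x A) {ρ} r t = t ≼-refl λ a m u → use-∃ʳ a (Right-≼ m r) λ n r₁ →
    reify A (subst (Right _ _) (instantiate A) r₁) (mono (⟦ A ⟧ (ρ [ x ↦ a ])) n ≤-refl u)

-- Dependence of truth on the valuation.

infix 3 _≈_
record _≈_ (X Y : Val) : Set where
  constructor _,_
  field
    fwd : ∀ {S i} → at X S i → at Y S i
    bwd : ∀ {S i} → at Y S i → at X S i
open _≈_

≈-reflexive : ∀ {X Y} → X ≡ Y → X ≈ Y
≈-reflexive refl = (λ t → t) , (λ t → t)

⋀-cong : ∀ {I} {X Y : I → Val} → (∀ ι → X ι ≈ Y ι) → ⋀ X ≈ ⋀ Y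
⋀-cong e = (λ t ι → fwd (e ι) (t ι)) , (λ t ι → bwd (e ι) (t ι))

⋁-cong : ∀ {I} {X Y : I → Val} → (∀ ι → X ι ≈ Y ι) → ⋁ X ≈ ⋁ Y
⋁-cong e = (λ t m k → t m λ ι n → k ι n ∘ fwd (e ι)) ,
           (λ t m k → t m λ ι n → k ι n ∘ bwd (e ι))

⇒-cong : ∀ {X X' Y Y'} → X ≈ X' → Y ≈ Y' → (X ⇒ Y) ≈ (X' ⇒ Y')
⇒-cong e e' = (λ t m le → fwd e' ∘ t m le ∘ bwd e) , (λ t m le → bwd e' ∘ t m le ∘ fwd e)

pair-cong : ∀ {X X' Y Y'} → X ≈ X' → Y ≈ Y' →
            ∀ b → (if b then X else Y) ≈ (if b then X' else Y')
pair-cong e e' true  = e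
pair-cong e e' false = e'

↦-≢ : ∀ ρ {x a z} → z ≢ x → (ρ [ x ↦ a ]) z ≡ ρ z
↦-≢ ρ {x} {z = z} z≢x rewrite dec-false (z ℕ.≟ x) z≢x = refl

agree-bind : ∀ {ρ ρ' a x} A → (∀ z → FreeIn z (all x A) → ρ z ≡ ρ' z) →
             ∀ z → FreeIn z A → (ρ [ x ↦ a ]) z ≡ (ρ' [ x ↦ a ]) z
agree-bind {x = x} A eq z z∈ with z ≡ᵇ x in z≡ᵇx
... | true  = refl
... | false = eq z (≡ᵇ-false z≡ᵇx , z∈)

coincidence : ∀ A {ρ ρ'} → (∀ z → FreeIn z A → ρ z ≡ ρ' z) → ⟦ A ⟧ ρ ≈ ⟦ A ⟧ ρ'
coincidence (atom p ts) eq = ≈-reflexive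
  (cong (λ us → atomᵛ (atom p us)) (map-cong-local (All.tabulate λ {z} z∈ → cong par (eq z z∈))))
coincidence ⊥'        eq = ≈-reflexive refl
coincidence (A ∧' B)  eq = ⋀-cong (pair-cong (coincidence A λ z → eq z ∘ inj₁)
                                             (coincidence B λ z → eq z ∘ inj₂))
coincidence (A ∨' B)  eq = ⋁-cong (pair-cong (coincidence A λ z → eq z ∘ inj₁)
                                             (coincidence B λ z → eq z ∘ inj₂))
coincidence (A ⊃ B)   eq = ⇒-cong (coincidence A λ z → eq z ∘ inj₁)
                                  (coincidence B λ z → eq z ∘ inj₂)
coincidence (all x A) eq = ⋀-cong λ a → coincidence A (agree-bind A eq)
coincidence (ex x A)  eq = ⋁-cong λ a → coincidence A (agree-bind A eq)

coincidence-↦ : ∀ B {ρ x a} → ¬ FreeIn x B → ⟦ B ⟧ (ρ [ x ↦ a ]) ≈ ⟦ B ⟧ ρ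
coincidence-↦ B {ρ} x∉ = coincidence B λ z z∈ → ↦-≢ ρ λ z≡x → x∉ (subst (λ w → FreeIn w B) z≡x z∈)

-- Settles the alternative of `FreeFor` in which a quantifier leaves nothing to substitute.
[/]-nonfree : ∀ A {x y} → ¬ FreeIn x A → A [ y / x ] ≡ A
[/]-nonfree (atom p ts) {x} {y} x∉ =
  cong (atom p) (map-id-local (All.tabulate λ {z} z∈ → ↦-≢ (λ w → w) {x} {y} λ { refl → x∉ z∈ }))
[/]-nonfree ⊥'        x∉ = refl
[/]-nonfree (A ∧' B)  x∉ = cong₂ _∧'_ ([/]-nonfree A (x∉ ∘ inj₁)) ([/]-nonfree B (x∉ ∘ inj₂))
[/]-nonfree (A ∨' B)  x∉ = cong₂ _∨'_ ([/]-nonfree A (x∉ ∘ inj₁)) ([/]-nonfree B (x∉ ∘ inj₂))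
[/]-nonfree (A ⊃ B)   x∉ = cong₂ _⊃_ ([/]-nonfree A (x∉ ∘ inj₁)) ([/]-nonfree B (x∉ ∘ inj₂))
[/]-nonfree (all z A) {x} x∉ with z ≡ᵇ x in z≡ᵇx
... | true  = refl
... | false = cong (all z) ([/]-nonfree A λ x∈ → x∉ (≡ᵇ-false z≡ᵇx ∘ sym , x∈))
[/]-nonfree (ex z A)  {x} x∉ with z ≡ᵇ x in z≡ᵇx
... | true  = refl
... | false = cong (ex z) ([/]-nonfree A λ x∈ → x∉ (≡ᵇ-false z≡ᵇx ∘ sym , x∈))

agree-bound : ∀ A {ρ ρ' : ℕ → ℕ} {x b z} → z ≡ x →
              (∀ w → FreeIn w (all z A) → (ρ [ x ↦ b ]) w ≡ ρ' w) →
              ∀ w → FreeIn w (all z A) → ρ w ≡ ρ' w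
agree-bound A {ρ} refl eq w w∈ = trans (sym (↦-≢ ρ (proj₁ w∈))) (eq w w∈)

mutual
  -- `ρ'` is only required to agree with `ρ [ x ↦ ρ y ]` on the free variables: under a binder the
  -- two updates come in the opposite order, and pointwise agreement is what persists.
  substitution : ∀ A {ρ ρ' x y} → FreeFor y x A →
                 (∀ z → FreeIn z A → (ρ [ x ↦ ρ y ]) z ≡ ρ' z) → ⟦ A [ y / x ] ⟧ ρ ≈ ⟦ A ⟧ ρ'
  substitution (atom p ts) {ρ} {x = x} _ eq = ≈-reflexive (cong (λ us → atomᵛ (atom p us))
    (trans (sym (map-∘ ts)) (map-cong-local (All.tabulate λ {z} z∈ →
      cong par (trans (if-float ρ (z ≡ᵇ x)) (eq z z∈))))))
  substitution ⊥'        _         eq = ≈-reflexive refl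
  substitution (A ∧' B)  (fa , fb) eq = ⋀-cong (pair-cong (substitution A fa λ z → eq z ∘ inj₁)
                                                          (substitution B fb λ z → eq z ∘ inj₂))
  substitution (A ∨' B)  (fa , fb) eq = ⋁-cong (pair-cong (substitution A fa λ z → eq z ∘ inj₁)
                                                          (substitution B fb λ z → eq z ∘ inj₂))
  substitution (A ⊃ B)   (fa , fb) eq = ⇒-cong (substitution A fa λ z → eq z ∘ inj₁)
                                               (substitution B fb λ z → eq z ∘ inj₂)
  substitution (all z A) {ρ} {ρ'} {x} ff eq with z ≡ᵇ x in z≡ᵇx
  ... | true  = coincidence (all z A) {ρ} {ρ'} (agree-bound A (≡ᵇ-true z≡ᵇx) eq)
  ... | false = ⋀-cong λ a → substitution-body A (≡ᵇ-false z≡ᵇx) ff eq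
  substitution (ex z A)  {ρ} {ρ'} {x} ff eq with z ≡ᵇ x in z≡ᵇx
  ... | true  = coincidence (ex z A) {ρ} {ρ'} (agree-bound A (≡ᵇ-true z≡ᵇx) eq)
  ... | false = ⋁-cong λ a → substitution-body A (≡ᵇ-false z≡ᵇx) ff eq

  substitution-body : ∀ A {ρ ρ' x y z a} → z ≢ x → FreeFor y x (all z A) →
                      (∀ w → FreeIn w (all z A) → (ρ [ x ↦ ρ y ]) w ≡ ρ' w) →
                      ⟦ A [ y / x ] ⟧ (ρ [ z ↦ a ]) ≈ ⟦ A ⟧ (ρ' [ z ↦ a ])
  substitution-body A {ρ} {ρ'} {x} {y} {z} {a} z≢x (inj₁ x∉) eq
    rewrite [/]-nonfree A {x} {y} (λ x∈ → x∉ (z≢x ∘ sym , x∈)) =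
    coincidence A (agree-bind A λ w w∈ →
      trans (sym (↦-≢ ρ λ { refl → x∉ w∈ })) (eq w w∈))
  substitution-body A {ρ} {ρ'} {x} {y} {z} {a} z≢x (inj₂ (z≢y , ff)) eq =
    substitution A ff agree
    where
    agree : ∀ w → FreeIn w A → (ρ [ z ↦ a ] [ x ↦ (ρ [ z ↦ a ]) y ]) w ≡ (ρ' [ z ↦ a ]) w
    agree w w∈ with w ≡ᵇ z in w≡ᵇz
    ... | true  rewrite ≡ᵇ-true {w} {z} w≡ᵇz | dec-false (z ℕ.≟ x) z≢x = refl
    -- As `y` is not captured, updating `z` leaves the value of `y` alone.
    ... | false rewrite dec-false (y ℕ.≟ z) (z≢y ∘ sym) = eq w (≡ᵇ-false w≡ᵇz , w∈)

-- Soundness of the model and the conclusion.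

sound : ∀ {A} → IF A → ∀ ρ S i → at (⟦ A ⟧ ρ) S i
sound (ax1 A B) ρ S i m _ a n le _ = mono (⟦ A ⟧ ρ) n le a
sound (ax2 A B C) ρ S i m _ f n le g p le' a =
  f (n ⨟ p) (≤-trans (to-mono p le) le') a ≼-refl ≤-refl (g p le' a)
sound (ax3 A B) ρ S i m _ a n le b = λ where
  true  → mono (⟦ A ⟧ ρ) n le a
  false → b
sound (ax4 A B) ρ S i m _ t = t true
sound (ax5 A B) ρ S i m _ t = t false
sound (ax6 A B) ρ S i m _ a n k = k true ≼-refl (mono (⟦ A ⟧ ρ) n ≤-refl a)
sound (ax7 A B) ρ S i m _ b n k = k false ≼-refl (mono (⟦ B ⟧ ρ) n ≤-refl b)
sound (ax8 A B C) ρ S i m _ f n le g p le' t = stable (⟦ C ⟧ ρ) λ q k → t q λ where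
  true  r a → k r (f (n ⨟ p ⨟ q ⨟ r) (to-mono r (to-mono q (≤-trans (to-mono p le) le'))) a)
  false r b → k r (g (p ⨟ q ⨟ r) (to-mono r (to-mono q le')) b)
sound (ax9 A) ρ S i m _ t = stable (⟦ A ⟧ ρ) λ n _ → t n λ ()
-- Suppose both disjuncts are refuted, with `A` true at `j` and `B` true at `j'`. The components are
-- linearly ordered: either `A` persists to `j'`, as required, or `B` persists to `j`, where `r`
-- refutes it.
sound (lin A B) ρ S i m k =
  k true ≼-refl λ n {j} le a → stable (⟦ B ⟧ ρ) λ p r →
  k false (n ⨟ p) λ q {j'} le' b → case ≤-total (to q (to p j)) j' of λ where
    (inj₁ j≤j') → mono (⟦ A ⟧ ρ) (p ⨟ q) j≤j' a
    (inj₂ j'≤j) → stable (⟦ A ⟧ ρ) λ s _ → r (q ⨟ s) (mono (⟦ B ⟧ ρ) s (to-mono s j'≤j) b)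
sound (q∀ A x y ff) ρ S i m _ t = bwd (substitution A ff λ _ _ → refl) (t (ρ y))
sound (q∃ A x y ff) ρ S i m _ t n k =
  k (ρ y) ≼-refl (mono (⟦ A ⟧ (ρ [ x ↦ ρ y ])) n ≤-refl (fwd (substitution A ff λ _ _ → refl) t))
sound (q∀⊃ A B x x∉) ρ S i m _ t n le b a = t a n le (bwd (coincidence-↦ B x∉) b)
sound (q∃⊃ A B x x∉) ρ S i m _ t n le e = stable (⟦ B ⟧ ρ) λ p k → e p λ a q u →
  k q (fwd (coincidence-↦ B x∉) (t a (n ⨟ p ⨟ q) (to-mono q (to-mono p le)) u))
-- The domain is the same at all components, so each instance `a` is treated in place: of the two
-- cases of `t a`, one contradicts the refuted instance `r`, the other the refutation of `B` in `k`.
sound (q∀∨ A B x x∉) ρ S i m _ t n k =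
  k true ≼-refl λ a → stable (⟦ A ⟧ (ρ [ x ↦ a ])) λ p r → t a (n ⨟ p) λ where
    true  q u → r q u
    false q u → k false (p ⨟ q) (fwd (coincidence-↦ B x∉) u)
sound (mp d e) ρ S i = sound e ρ S i ≼-refl ≤-refl (sound d ρ S i)
sound (gen x d) ρ S i a = sound d (ρ [ x ↦ a ]) S i

-- The formula occurs on the right of the only component and is true there by soundness, so `reify`
-- yields the derivation.
theorem3 : (A : IFm) (σ : ℕ → ℕ) → DistinctOnFree σ A → IF A →
    LNIF (([] ⊢ (A ′[ σ ]) ∷ []) ∷ [])
theorem3 A σ _ d = reify A (occʳ (here refl)) (sound d σ _ zero)
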